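{- Suppose $k\ge 3$ and $\sigma$ is a restrictive permutation of length $k$. Then for all $n\ge 0$ we have $$|F_n(123,\sigma)|=\sum_{j=0}^{k-1}\binom{n-1}{j}.$$
   Context: A permutation contains a pattern $\sigma$ if some subsequence of it has the same length and relative order as $\sigma$; otherwise it avoids $\sigma$. A copy of the Fishburn pattern $f$ in a permutation $\pi$ (in one-line notation) is a subsequence $\pi_j,\pi_{j+1},\pi_k$ with $j+1<k$, $\pi_j=\pi_k+1$, and $\pi_{j+1}>\pi_j$; a Fishburn permutation is one with no copy of $f$. $F_n(\sigma_1,\dots,\sigma_m)$ is the set of Fishburn permutations of length $n$ avoiding each $\sigma_i$. A permutation $\sigma$ is restrictive if $\sigma$ avoids $123$, $\sigma$ contains $f$, and $\sigma$ avoids both $2413$ and $3412$. For $n=0$ the convention $\binom{ -1}{0}=1$ and $\binom{ -1}{j}=0$ for $j\ge1$ is used. -}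

module Defs where

open import Data.Fin.Base using (Fin; toℕ) renaming (_<_ to _<ᶠ_)
open import Data.Fin.Patterns using (0F; 1F; 2F; 3F)
open import Data.Fin.Permutation using (Permutation′; permutation; id; _⟨$⟩ʳ_)
open import Data.List.Base using (List)
open import Data.List.Relation.Unary.All using (All)
open import Data.Nat.Base using (ℕ; zero; suc)
open import Data.Nat.Combinatorics using (_C_)
open import Data.Product.Base using (Σ; ∃; ∃-syntax; _×_; _,_)
open import Data.Vec.Base using (Vec; []; _∷_; lookup)
open import Function.Bundles using (Inverse; _⇔_)
open import Level using (0ℓ)
open import Relation.Binary.Bundles using (Setoid)
import Relation.Binary.Construct.On as On
open import Relation.Binary.PropositionalEquality using (_≡_; refl; setoid; _→-setoid_)
open import Relation.Nullary using (¬_)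

-- A permutation of length n is a bijection of Fin n, so positions and values
-- run over 0, …, n-1; position i of the one-line notation holds π ⟨$⟩ʳ i.

Contains : ∀ {n k} → Permutation′ n → Permutation′ k → Set
Contains {n} {k} π σ =
  Σ (Fin k → Fin n) λ ι →
    (∀ {a b} → a <ᶠ b → ι a <ᶠ ι b) ×
    (∀ a b → (π ⟨$⟩ʳ ι a <ᶠ π ⟨$⟩ʳ ι b) ⇔ (σ ⟨$⟩ʳ a <ᶠ σ ⟨$⟩ʳ b))

Avoids : ∀ {n k} → Permutation′ n → Permutation′ k → Set
Avoids π σ = ¬ Contains π σ

ContainsFishburn : ∀ {n} → Permutation′ n → Set
ContainsFishburn {n} π =
  Σ (Fin n) λ j → Σ (Fin n) λ j′ → Σ (Fin n) λ k →
    toℕ j′ ≡ suc (toℕ j) ×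
    j′ <ᶠ k ×
    toℕ (π ⟨$⟩ʳ j) ≡ suc (toℕ (π ⟨$⟩ʳ k)) ×
    π ⟨$⟩ʳ j <ᶠ π ⟨$⟩ʳ j′

Fishburn : ∀ {n} → Permutation′ n → Set
Fishburn π = ¬ ContainsFishburn π

p123 : Permutation′ 3
p123 = id

p2413 : Permutation′ 4
p2413 = permutation
  (lookup (1F ∷ 3F ∷ 0F ∷ 2F ∷ []))
  (lookup (2F ∷ 0F ∷ 3F ∷ 1F ∷ []))
  (λ { 0F → refl ; 1F → refl ; 2F → refl ; 3F → refl })
  (λ { 0F → refl ; 1F → refl ; 2F → refl ; 3F → refl })

p3412 : Permutation′ 4
p3412 = permutation
  (lookup (2F ∷ 3F ∷ 0F ∷ 1F ∷ []))
  (lookup (2F ∷ 3F ∷ 0F ∷ 1F ∷ []))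
  (λ { 0F → refl ; 1F → refl ; 2F → refl ; 3F → refl })
  (λ { 0F → refl ; 1F → refl ; 2F → refl ; 3F → refl })

Restrictive : ∀ {k} → Permutation′ k → Set
Restrictive σ =
  Avoids σ p123 × ContainsFishburn σ × Avoids σ p2413 × Avoids σ p3412

Pattern : Set
Pattern = ∃ Permutation′

-- Two elements of F n σs are equal when their one-line notations agree;
-- proofs of membership and the chosen inverse functions are disregarded.
F : ℕ → List Pattern → Setoid 0ℓ 0ℓ
F n σs = On.setoid {B = Carrier} (Fin n →-setoid Fin n) (λ (π , _) → π ⟨$⟩ʳ_)
  where
  Carrier : Set
  Carrier = ∃[ π ] (Fishburn {n} π × All (λ (_ , σ) → Avoids π σ) σs)

-- "The set S has exactly N elements."
∣_∣≡_ : Setoid 0ℓ 0ℓ → ℕ → Set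
∣ S ∣≡ N = Inverse S (setoid (Fin N))

infix 4 ∣_∣≡_

-- binom₋₁ n j is the binomial coefficient (n-1 choose j), where
-- (-1 choose 0) = 1 and (-1 choose j) = 0 for j ≥ 1.
binom₋₁ : ℕ → ℕ → ℕ
binom₋₁ zero    zero    = 1
binom₋₁ zero    (suc _) = 0
binom₋₁ (suc n) j       = n C j

{-# OPTIONS --safe #-}
-- In a 123-avoiding Fishburn permutation the bottom of every ascent is the
-- least value: otherwise the value one below it gives a 123 on its left or an
-- f on its right.  So such a permutation of length m + 1 is D₁ 0 D₂ with D₁
-- and D₂ decreasing, and it is encoded by the word in {D₁, D₂} that tells for
-- each of the values 1, …, m to which block it belongs.  A restrictive σ is
-- likewise D₁ D₂ with decreasing blocks, since two ascents would give 123, 2413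
-- or 3412; its least value lies in D₂, so it can only use non-zero values of
-- D₁ 0 D₂, and containment of σ is the subword relation.  Finally the number
-- of words of length m avoiding a subword of length k depends only on m and k,
-- by greedy matching.
module Submission where

open import Defs
open import Data.Bool.Base using (Bool; true; false; not)
import Data.Bool.Properties as Bool
open import Data.Empty using (⊥; ⊥-elim; ⊥-elim-irr)
open import Data.Fin.Base
  using (Fin; zero; suc; toℕ; fromℕ; inject₁; punchIn; punchOut; splitAt; _↑ˡ_; _↑ʳ_)
  renaming (_<_ to _<ᶠ_; _≤_ to _≤ᶠ_)
open import Data.Fin.Patterns using (0F; 1F; 2F; 3F)
open import Data.Fin.Permutation
  using (Permutation′; id; flip; insert; inverseˡ; inverseʳ; _⟨$⟩ʳ_; _⟨$⟩ˡ_)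
open import Data.Fin.Properties
  using (<-cmp; <-trans; <-irrefl; <-asym; _≟_; _≤?_; toℕ<n; toℕ-inject₁; toℕ-fromℕ;
         ≤-antisym; ≤∧≢⇒<; punchIn-mono-≤; punchIn-injective; punchIn-punchOut;
         splitAt-↑ˡ; splitAt-↑ʳ; join-splitAt)
open import Data.List.Base using ([]; _∷_; map; upTo; applyUpTo)
open import Data.List.Properties using (map-upTo)
open import Data.List.Relation.Unary.All using ([]; _∷_)
open import Data.Nat.Base using (ℕ; zero; suc; _+_; z≤n; s≤s; z<s; s<s; _<_; _≤_)
open import Data.Nat.Combinatorics using (_C_; nCk+nC[k+1]≡[n+1]C[k+1])
open import Data.Nat.ListAction using (sum)
import Data.Nat.Properties as ℕ
open import Data.Product.Base using (∃-syntax; _×_; _,_; proj₁; proj₂)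
open import Data.Sum.Base using (inj₁; inj₂; [_,_]′)
open import Data.Vec.Base using (Vec; []; _∷_; lookup; tabulate)
open import Data.Vec.Properties using (lookup∘tabulate; tabulate∘lookup; tabulate-cong)
open import Function.Base using (_∘_)
open import Function.Bundles using (Inverse; mk⇔; Equivalence)
open import Function.Construct.Composition using (inverse)
open import Relation.Binary.Bundles using (Setoid)
import Relation.Binary.Construct.On as On
open import Relation.Binary.Definitions using (Tri; tri<; tri≈; tri>)
open import Relation.Binary.PropositionalEquality
open import Relation.Nullary using (¬_; Dec; yes; no; does; contradiction)
open import Relation.Nullary.Decidable using (dec-true; dec-false)
open import Level using (0ℓ)

private
  variable
    k m n : ℕ

-- Strictly monotone maps and adjacent ascents

StrictMono : (Fin k → Fin n) → Set
StrictMono f = ∀ {i j} → i <ᶠ j → f i <ᶠ f j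

step⇒strictMono : (f : Fin (suc k) → Fin n) → (∀ i → f (inject₁ i) <ᶠ f (suc i)) → StrictMono f
step⇒strictMono {suc k} f step {zero}  {suc zero}    _         = step zero
step⇒strictMono {suc k} f step {zero}  {suc (suc j)} _         =
  <-trans (step zero) (step⇒strictMono (f ∘ suc) (step ∘ suc) {zero} {suc j} z<s)
step⇒strictMono {suc k} f step {suc i} {suc j}       (s<s i<j) =
  step⇒strictMono (f ∘ suc) (step ∘ suc) i<j

strictMono-cancel : {f : Fin k → Fin n} → StrictMono f → ∀ {i j} → f i <ᶠ f j → i <ᶠ j
strictMono-cancel {f = f} mono {i} {j} fi<fj with <-cmp i j
... | tri< i<j _ _  = i<j
... | tri≈ _ refl _ = contradiction fi<fj (<-irrefl refl)
... | tri> _ _ j<i  = contradiction fi<fj (<-asym (mono j<i))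

-- The image of `suc i` exceeds that of its predecessor `inject₁ i`, which is handled by restricting
-- `f` to all but its last argument. This bound later shows that a word determines its permutation.
strictMono⇒inflationary : (f : Fin k → Fin n) → StrictMono f → ∀ i → toℕ i ≤ toℕ (f i)
strictMono⇒inflationary f mono zero = z≤n
strictMono⇒inflationary {suc (suc k)} f mono (suc i) =
  ℕ.≤-<-trans
    (strictMono⇒inflationary (f ∘ inject₁)
      (λ {a} {b} a<b → mono (subst₂ _<_ (sym (toℕ-inject₁ a)) (sym (toℕ-inject₁ b)) a<b)) i)
    (mono (ℕ.≤-reflexive (cong suc (toℕ-inject₁ i))))

-- Starting at `p`, either the next entry is larger, or it is no larger and hence still below `f q`,
-- so the search moves on. The bound `j′ ≤ᶠ q` keeps the ascent within a prefix.
adjacentAscent : (f : Fin k → Fin n) → ∀ {p q} → p <ᶠ q → f p <ᶠ f q →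
  ∃[ j ] ∃[ j′ ] toℕ j′ ≡ suc (toℕ j) × j′ ≤ᶠ q × f j <ᶠ f j′
adjacentAscent {suc k} f {suc p} {suc q} (s<s p<q) fp<fq =
  let j , j′ , eq , le , lt = adjacentAscent {k} (f ∘ suc) p<q fp<fq
  in suc j , suc j′ , cong suc eq , s≤s le , lt
adjacentAscent {suc k} f {zero} {suc zero} _ f0<f1 = zero , 1F , refl , ℕ.≤-refl , f0<f1
adjacentAscent {suc k} f {zero} {suc q@(suc _)} _ f0<fq =
  [ (λ f0<f1 → zero , 1F , refl , s≤s z≤n , f0<f1)
  , (λ f1≤f0 →
      let j , j′ , eq , le , lt = adjacentAscent {k} (f ∘ suc) z<s (ℕ.≤-<-trans f1≤f0 f0<fq)
      in suc j , suc j′ , cong suc eq , s≤s le , lt)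
  ]′ (ℕ.<-≤-connex (toℕ (f zero)) (toℕ (f 1F)))

does-true⇒ : {P : Set} (P? : Dec P) → does P? ≡ true → P
does-true⇒ (yes p) _ = p

does-false⇒ : {P : Set} (P? : Dec P) → does P? ≡ false → ¬ P
does-false⇒ (no ¬p) _ = ¬p

module _ (π : Permutation′ n) where

  ˡ-injective : ∀ {x y} → π ⟨$⟩ˡ x ≡ π ⟨$⟩ˡ y → x ≡ y
  ˡ-injective eq = trans (sym (inverseʳ π)) (trans (cong (π ⟨$⟩ʳ_) eq) (inverseʳ π))

  ʳ-injective : ∀ {x y} → π ⟨$⟩ʳ x ≡ π ⟨$⟩ʳ y → x ≡ y
  ʳ-injective eq = trans (sym (inverseˡ π)) (trans (cong (π ⟨$⟩ˡ_) eq) (inverseˡ π))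

-- Copies of patterns

-- `G` lists the values of the copy in increasing order; its monotonicity yields both directions of
-- the order equivalence at once.
contains-intro : (π : Permutation′ n) (τ : Permutation′ k) (ι G : Fin k → Fin n) →
  StrictMono ι → StrictMono G → (∀ a → π ⟨$⟩ʳ ι a ≡ G (τ ⟨$⟩ʳ a)) → Contains π τ
contains-intro π τ ι G ι-mono G-mono eq = ι , ι-mono , λ a b → mk⇔
  (λ lt → strictMono-cancel G-mono (subst₂ _<ᶠ_ (eq a) (eq b) lt))
  (λ lt → subst₂ _<ᶠ_ (sym (eq a)) (sym (eq b)) (G-mono lt))

contains-123 : (π : Permutation′ n) → ∀ {p q r} → p <ᶠ q → q <ᶠ r →
  π ⟨$⟩ʳ p <ᶠ π ⟨$⟩ʳ q → π ⟨$⟩ʳ q <ᶠ π ⟨$⟩ʳ r → Contains π p123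
contains-123 π {p} {q} {r} p<q q<r A<B B<C = contains-intro π p123
  (lookup (p ∷ q ∷ r ∷ []))
  (lookup ((π ⟨$⟩ʳ p) ∷ (π ⟨$⟩ʳ q) ∷ (π ⟨$⟩ʳ r) ∷ []))
  (step⇒strictMono _ λ { 0F → p<q ; 1F → q<r })
  (step⇒strictMono _ λ { 0F → A<B ; 1F → B<C })
  (λ { 0F → refl ; 1F → refl ; 2F → refl })

-- With values `A < B` and `C < D`, a shared middle position, `A < C` or `B < D` gives 123.
-- Otherwise `C` is the least and `B` the greatest, and comparing `A` with `D` gives 2413 or 3412.
noTwoRises : (σ : Permutation′ n) → Restrictive σ → ∀ {p q r s} →
  p <ᶠ q → q ≤ᶠ r → r <ᶠ s → σ ⟨$⟩ʳ p <ᶠ σ ⟨$⟩ʳ q → ¬ (σ ⟨$⟩ʳ r <ᶠ σ ⟨$⟩ʳ s)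
noTwoRises σ (no123 , _ , no2413 , no3412) {p} {q} {r} {s} p<q q≤r r<s A<B C<D with q ≟ r
... | yes refl = no123 (contains-123 σ p<q r<s A<B C<D)
... | no q≢r = cases (<-cmp A C) (<-cmp B D) (<-cmp A D)
  where
  A = σ ⟨$⟩ʳ p
  B = σ ⟨$⟩ʳ q
  C = σ ⟨$⟩ʳ r
  D = σ ⟨$⟩ʳ s
  q<r : q <ᶠ r
  q<r = ≤∧≢⇒< q≤r q≢r
  distinct : ∀ {i j} → i <ᶠ j → σ ⟨$⟩ʳ i ≢ σ ⟨$⟩ʳ j
  distinct i<j eq = <-irrefl (ʳ-injective σ eq) i<j
  cases : Tri (A <ᶠ C) (A ≡ C) (C <ᶠ A) → Tri (B <ᶠ D) (B ≡ D) (D <ᶠ B) → Tri (A <ᶠ D) (A ≡ D) (D <ᶠ A) → ⊥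
  cases (tri< A<C _ _) _ _ = no123 (contains-123 σ (<-trans p<q q<r) r<s A<C C<D)
  cases (tri≈ _ A≡C _) _ _ = distinct (<-trans p<q q<r) A≡C
  cases _ (tri< B<D _ _) _ = no123 (contains-123 σ p<q (<-trans q<r r<s) A<B B<D)
  cases _ (tri≈ _ B≡D _) _ = distinct (<-trans q<r r<s) B≡D
  cases _ _ (tri≈ _ A≡D _) = distinct (<-trans p<q (<-trans q<r r<s)) A≡D
  cases (tri> _ _ C<A) (tri> _ _ D<B) (tri< A<D _ _) = no2413 (contains-intro σ p2413
    (lookup (p ∷ q ∷ r ∷ s ∷ []))
    (lookup (C ∷ A ∷ D ∷ B ∷ []))
    (step⇒strictMono _ λ { 0F → p<q ; 1F → q<r ; 2F → r<s })
    (step⇒strictMono _ λ { 0F → C<A ; 1F → A<D ; 2F → D<B })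
    (λ { 0F → refl ; 1F → refl ; 2F → refl ; 3F → refl }))
  cases (tri> _ _ C<A) (tri> _ _ D<B) (tri> _ _ D<A) = no3412 (contains-intro σ p3412
    (lookup (p ∷ q ∷ r ∷ s ∷ []))
    (lookup (C ∷ D ∷ A ∷ B ∷ []))
    (step⇒strictMono _ λ { 0F → p<q ; 1F → q<r ; 2F → r<s })
    (step⇒strictMono _ λ { 0F → C<D ; 1F → D<A ; 2F → A<B })
    (λ { 0F → refl ; 1F → refl ; 2F → refl ; 3F → refl }))

-- Two decreasing blocks

-- The one-line notation of π is the decreasing list of the values with letter
-- true followed by the decreasing list of the values with letter false.
record Unshuffles (W : Vec Bool n) (π : Permutation′ n) : Set where
  field
    falling : ∀ {x y} → x <ᶠ y → lookup W x ≡ lookup W y → π ⟨$⟩ˡ y <ᶠ π ⟨$⟩ˡ x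
    split   : ∀ {x y} → lookup W x ≡ true → lookup W y ≡ false → π ⟨$⟩ˡ x <ᶠ π ⟨$⟩ˡ y

  rise : ∀ {x y} → x <ᶠ y → π ⟨$⟩ˡ x <ᶠ π ⟨$⟩ˡ y → lookup W x ≡ true × lookup W y ≡ false
  rise {x} {y} x<y px<py with lookup W x in Wx | lookup W y in Wy
  ... | true  | false = refl , refl
  ... | true  | true  = contradiction px<py (<-asym (falling x<y (trans Wx (sym Wy))))
  ... | false | false = contradiction px<py (<-asym (falling x<y (trans Wx (sym Wy))))
  ... | false | true  = contradiction px<py (<-asym (split Wy Wx))

  true-downward : ∀ {x y} → lookup W y ≡ true → π ⟨$⟩ˡ x ≤ᶠ π ⟨$⟩ˡ y → lookup W x ≡ true
  true-downward {x} Wy px≤py with lookup W x in Wx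
  ... | true  = refl
  ... | false = contradiction px≤py (ℕ.<⇒≱ (split Wy Wx))

  false-upward : ∀ {x y} → lookup W x ≡ false → π ⟨$⟩ˡ x ≤ᶠ π ⟨$⟩ˡ y → lookup W y ≡ false
  false-upward {x} {y} Wx px≤py with lookup W y in Wy
  ... | false = refl
  ... | true  = contradiction px≤py (ℕ.<⇒≱ (split Wy Wx))

open Unshuffles

module _ {V : Vec Bool k} {σ : Permutation′ k} {W : Vec Bool n} {π : Permutation′ n}
         (Vσ : Unshuffles V σ) (Wπ : Unshuffles W π)
         (G : Fin k → Fin n) (G-mono : StrictMono G) (letters : ∀ x → lookup W (G x) ≡ lookup V x) where

  -- The relative position of two values depends only on their order and their letters, and `G`
  -- preserves both.
  positions-preserved : ∀ {x y} → σ ⟨$⟩ˡ x <ᶠ σ ⟨$⟩ˡ y → π ⟨$⟩ˡ G x <ᶠ π ⟨$⟩ˡ G y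
  positions-preserved {x} {y} px<py with <-cmp x y
  ... | tri≈ _ refl _ = contradiction px<py (<-irrefl refl)
  ... | tri< x<y _ _ =
    let Vx , Vy = rise Vσ x<y px<py
    in split Wπ (trans (letters x) Vx) (trans (letters y) Vy)
  ... | tri> _ _ y<x with lookup V x in Vx | lookup V y in Vy
  ...   | true  | false = split Wπ (trans (letters x) Vx) (trans (letters y) Vy)
  ...   | false | true  = contradiction px<py (<-asym (split Vσ Vy Vx))
  ...   | true  | true  = falling Wπ (G-mono y<x)
    (trans (trans (letters y) Vy) (sym (trans (letters x) Vx)))
  ...   | false | false = falling Wπ (G-mono y<x)
    (trans (trans (letters y) Vy) (sym (trans (letters x) Vx)))

  contains-of-letters : Contains π σ
  contains-of-letters = contains-intro π σ (λ a → π ⟨$⟩ˡ G (σ ⟨$⟩ʳ a)) G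
    (λ a<b → positions-preserved (subst₂ _<ᶠ_ (sym (inverseˡ σ)) (sym (inverseˡ σ)) a<b))
    G-mono (λ a → inverseʳ π)

unshuffles-inflationary : {W : Vec Bool n} {π ρ : Permutation′ n} → Unshuffles W π → Unshuffles W ρ →
  ∀ i → i ≤ᶠ ρ ⟨$⟩ˡ (π ⟨$⟩ʳ i)
unshuffles-inflationary {π = π} {ρ} Wπ Wρ = strictMono⇒inflationary _ λ i<j →
  positions-preserved Wπ Wρ (λ x → x) (λ lt → lt) (λ _ → refl)
    (subst₂ _<ᶠ_ (sym (inverseˡ π)) (sym (inverseˡ π)) i<j)

-- The position changes from `π` to `ρ` and back are both inflationary and mutually inverse, so each
-- is the identity.
unshuffles-unique : {W : Vec Bool n} {π ρ : Permutation′ n} → Unshuffles W π → Unshuffles W ρ →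
  ∀ i → π ⟨$⟩ʳ i ≡ ρ ⟨$⟩ʳ i
unshuffles-unique {π = π} {ρ} Wπ Wρ i =
  trans (sym (inverseʳ ρ)) (cong (ρ ⟨$⟩ʳ_) (≤-antisym
    (subst (λ z → j ≤ᶠ z) (trans (cong (π ⟨$⟩ˡ_) (inverseʳ ρ)) (inverseˡ π))
      (unshuffles-inflationary Wρ Wπ j))
    (unshuffles-inflationary Wπ Wρ i)))
  where j = ρ ⟨$⟩ˡ (π ⟨$⟩ʳ i)

-- The permutation of a word

punchIn-< : (i : Fin (suc n)) (j : Fin n) → toℕ j < toℕ i → toℕ (punchIn i j) ≡ toℕ j
punchIn-< (suc i) zero    _         = refl
punchIn-< (suc i) (suc j) (s<s j<i) = cong suc (punchIn-< i j j<i)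

punchIn-≥ : (i : Fin (suc n)) (j : Fin n) → toℕ i ≤ toℕ j → toℕ (punchIn i j) ≡ suc (toℕ j)
punchIn-≥ zero    j       _         = refl
punchIn-≥ (suc i) (suc j) (s≤s i≤j) = cong suc (punchIn-≥ i j i≤j)

punchIn-strictMono : (i : Fin (suc n)) → StrictMono (punchIn i)
punchIn-strictMono i {a} {b} a<b =
  ≤∧≢⇒< (punchIn-mono-≤ i a b (ℕ.<⇒≤ a<b)) λ eq → <-irrefl (punchIn-injective i a b eq) a<b

-- The number of letters `true`, which is the position where the second block starts.
boundary : Vec Bool n → Fin (suc n)
boundary []          = zero
boundary (true  ∷ W) = suc (boundary W)
boundary (false ∷ W) = inject₁ (boundary W)

-- The least value ends its block.
leastPosition : Bool → Vec Bool n → Fin (suc n)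
leastPosition true  W = boundary W
leastPosition false W = fromℕ _

-- Sends values to positions, so it is the inverse of the one-line notation: the head of the word
-- belongs to the least value, which is inserted last.
place : Vec Bool n → Permutation′ n
place []      = id
place (b ∷ W) = insert zero (leastPosition b W) (place W)

-- A least value inserted at the end of the first block leaves that block in place and shifts the
-- second by one; inserted at the very end, it moves nothing.
place-< : (W : Vec Bool n) → ∀ x → lookup W x ≡ true → toℕ (place W ⟨$⟩ʳ x) < toℕ (boundary W)
place-< (true  ∷ W) zero    _  = ℕ.≤-refl
place-< (true  ∷ W) (suc x) Wx =
  s≤s (ℕ.≤-trans (ℕ.≤-reflexive (punchIn-< (boundary W) _ (place-< W x Wx))) (ℕ.<⇒≤ (place-< W x Wx)))
place-< {suc n} (false ∷ W) (suc x) Wx =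
  subst₂ _<_
    (sym (punchIn-< (fromℕ _) _ (subst (toℕ (place W ⟨$⟩ʳ x) <_) (sym (toℕ-fromℕ n)) (toℕ<n _))))
    (sym (toℕ-inject₁ (boundary W))) (place-< W x Wx)

place-≥ : (W : Vec Bool n) → ∀ x → lookup W x ≡ false → toℕ (boundary W) ≤ toℕ (place W ⟨$⟩ʳ x)
place-≥ (true  ∷ W) (suc x) Wx =
  ℕ.≤-trans (s≤s (place-≥ W x Wx)) (ℕ.≤-reflexive (sym (punchIn-≥ (boundary W) _ (place-≥ W x Wx))))
place-≥ {suc n} (false ∷ W) zero _ =
  subst₂ _≤_ (sym (toℕ-inject₁ (boundary W))) (sym (toℕ-fromℕ n)) (ℕ.≤-pred (toℕ<n (boundary W)))
place-≥ {suc n} (false ∷ W) (suc x) Wx =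
  subst₂ _≤_ (sym (toℕ-inject₁ (boundary W)))
    (sym (punchIn-< (fromℕ _) _ (subst (toℕ (place W ⟨$⟩ʳ x) <_) (sym (toℕ-fromℕ n)) (toℕ<n _))))
    (place-≥ W x Wx)

punchIn-below : (i : Fin (suc n)) (j : Fin n) → toℕ j < toℕ i → punchIn i j <ᶠ i
punchIn-below i j j<i = subst (_< toℕ i) (sym (punchIn-< i j j<i)) j<i

place-falling : (W : Vec Bool n) → ∀ {x y} → x <ᶠ y → lookup W x ≡ lookup W y →
  place W ⟨$⟩ʳ y <ᶠ place W ⟨$⟩ʳ x
place-falling (true ∷ W) {zero} {suc y} _ eq = punchIn-below (boundary W) _ (place-< W y (sym eq))
place-falling {suc n} (false ∷ W) {zero} {suc y} _ eq =
  punchIn-below (fromℕ n) _ (subst (toℕ (place W ⟨$⟩ʳ y) <_) (sym (toℕ-fromℕ n)) (toℕ<n _))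
place-falling (b ∷ W) {suc x} {suc y} (s<s x<y) eq =
  punchIn-strictMono (leastPosition b W) (place-falling W x<y eq)

unshuffle : Vec Bool n → Permutation′ n
unshuffle W = flip (place W)

unshuffle-unshuffles : (W : Vec Bool n) → Unshuffles W (unshuffle W)
unshuffle-unshuffles W = record
  { falling = place-falling W
  ; split   = λ {x} {y} Wx Wy → ℕ.<-≤-trans (place-< W x Wx) (place-≥ W y Wy)
  }

-- 123-avoiding Fishburn permutations

-- The value `zero` gets no letter of its own: it always closes the first block, and prefixing
-- `true` accounts for it.
fishburnWord : Permutation′ (suc m) → Vec Bool m
fishburnWord π = tabulate λ v → does (π ⟨$⟩ˡ suc v ≤? π ⟨$⟩ˡ zero)

module _ (π : Permutation′ (suc m)) where

  private
    W : Vec Bool (suc m)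
    W = true ∷ fishburnWord π
    pos = π ⟨$⟩ˡ_

  lookup-word : ∀ x → lookup W x ≡ does (pos x ≤? pos zero)
  lookup-word zero    = sym (dec-true (pos zero ≤? pos zero) ℕ.≤-refl)
  lookup-word (suc v) = lookup∘tabulate _ v

  word-true : ∀ x → lookup W x ≡ true → pos x ≤ᶠ pos zero
  word-true x Wx = does-true⇒ (pos x ≤? pos zero) (trans (sym (lookup-word x)) Wx)

  word-false : ∀ x → lookup W x ≡ false → pos zero <ᶠ pos x
  word-false x Wx = ℕ.≰⇒> (does-false⇒ (pos x ≤? pos zero) (trans (sym (lookup-word x)) Wx))

  -- An increasing pair left of `zero` is excluded by `noRiseBeforeZero`; one right of it forms a
  -- 123 with `zero`.
  fishburn⇒unshuffles : Fishburn π → Avoids π p123 → Unshuffles W π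
  fishburn⇒unshuffles fish no123 = record
    { falling = falling′
    ; split   = λ {x} {y} Wx Wy → ℕ.≤-<-trans (word-true x Wx) (word-false y Wy)
    }
    where
    contains-123-values : ∀ {x y z} → pos x <ᶠ pos y → pos y <ᶠ pos z → x <ᶠ y → y <ᶠ z → ⊥
    contains-123-values px<py py<pz x<y y<z = no123 (contains-123 π px<py py<pz
      (subst₂ _<ᶠ_ (sym (inverseʳ π)) (sym (inverseʳ π)) x<y)
      (subst₂ _<ᶠ_ (sym (inverseʳ π)) (sym (inverseʳ π)) y<z))

    pred-value : ∀ (y : Fin (suc m)) → y ≢ zero → ∃[ x ] toℕ y ≡ suc (toℕ x)
    pred-value zero    y≢0 = contradiction refl y≢0
    pred-value (suc x) _   = inject₁ x , cong suc (sym (toℕ-inject₁ x))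

    -- Such a pair yields adjacent entries `a < b` in the prefix. The value `c = a - 1` forms 123
    -- with them if it stands on their left and a copy of f if on their right.
    noRiseBeforeZero : ∀ {x y} → x <ᶠ y → pos x <ᶠ pos y → ¬ (pos y ≤ᶠ pos zero)
    noRiseBeforeZero {x} {y} x<y px<py py≤p0
      with j , j′ , eq , j′≤ , lt ←
        adjacentAscent (π ⟨$⟩ʳ_) px<py (subst₂ _<ᶠ_ (sym (inverseʳ π)) (sym (inverseʳ π)) x<y)
      -- The position `j` is strictly left of that of `zero`, so its value has a predecessor.
      with c , a≡c+1 ← pred-value (π ⟨$⟩ʳ j) (λ a≡0 → ℕ.<⇒≱
        (ℕ.<-≤-trans (ℕ.≤-reflexive (sym eq)) (ℕ.≤-trans j′≤ py≤p0))
        (ℕ.≤-reflexive (cong toℕ (trans (cong pos (sym a≡0)) (inverseˡ π)))))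
      = cases (<-cmp (pos c) j) (<-cmp (pos c) j′)
      where
      c<a : c <ᶠ π ⟨$⟩ʳ j
      c<a = ℕ.≤-reflexive (sym a≡c+1)
      pc≡ : π ⟨$⟩ʳ pos c ≡ c
      pc≡ = inverseʳ π
      cases : Tri (pos c <ᶠ j) (pos c ≡ j) (j <ᶠ pos c) → Tri (pos c <ᶠ j′) (pos c ≡ j′) (j′ <ᶠ pos c) → ⊥
      cases (tri< c<j _ _) _ = no123 (contains-123 π c<j (ℕ.≤-reflexive (sym eq))
        (subst (_<ᶠ π ⟨$⟩ʳ j) (sym pc≡) c<a) lt)
      cases (tri≈ _ c≡j _) _ = <-irrefl (trans (sym pc≡) (cong (π ⟨$⟩ʳ_) c≡j)) c<a
      cases (tri> _ _ j<c) (tri< c<j′ _ _) = ℕ.<⇒≱ c<j′ (subst (_≤ toℕ (pos c)) (sym eq) j<c)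
      cases _ (tri≈ _ c≡j′ _) =
        <-asym lt (subst (_<ᶠ π ⟨$⟩ʳ j) (trans (sym pc≡) (cong (π ⟨$⟩ʳ_) c≡j′)) c<a)
      cases _ (tri> _ _ j′<c) =
        fish (j , j′ , pos c , eq , j′<c , trans a≡c+1 (cong (suc ∘ toℕ) (sym pc≡)) , lt)

    falling′ : ∀ {x y} → x <ᶠ y → lookup W x ≡ lookup W y → pos y <ᶠ pos x
    falling′ {x} {y} x<y eq with <-cmp (pos x) (pos y)
    ... | tri> _ _ py<px = py<px
    ... | tri≈ _ px≡py _ = contradiction x<y (<-irrefl (ˡ-injective π px≡py))
    ... | tri< px<py _ _ with lookup W x in Wx
    ...   | true  = contradiction (word-true y (sym eq)) (noRiseBeforeZero x<y px<py)
    ...   | false = ⊥-elim (contains-123-values (word-false x Wx) px<py (x>0 x Wx) x<y)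
      where
      x>0 : ∀ x → lookup W x ≡ false → zero {n = m} <ᶠ x
      x>0 (suc x) _ = z<s

  module _ {u : Vec Bool m} (Uπ : Unshuffles (true ∷ u) π) where

    -- The middle value would be the top of one rise and the bottom of another, hence carry both
    -- letters.
    unshuffles⇒avoids123 : Avoids π p123
    unshuffles⇒avoids123 (ι , mono , iff)
      with rise₀₁ ← rise Uπ (Equivalence.from (iff 0F 1F) z<s)
        (subst₂ _<ᶠ_ (sym (inverseˡ π)) (sym (inverseˡ π)) (mono {0F} {1F} z<s))
      with rise₁₂ ← rise Uπ (Equivalence.from (iff 1F 2F) (s<s z<s))
        (subst₂ _<ᶠ_ (sym (inverseˡ π)) (sym (inverseˡ π)) (mono {1F} {2F} (s<s z<s)))
      with () ← trans (sym (proj₂ rise₀₁)) (proj₁ rise₁₂)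

    -- The adjacent ascent crosses the boundary. Its bottom is a successor, so `zero`, the last
    -- entry of the first block, would stand strictly between the two adjacent entries.
    unshuffles⇒fishburn : Fishburn π
    unshuffles⇒fishburn (j , j′ , l , eq , j′<l , a≡c+1 , a<b)
      with Wa , Wb ← rise Uπ a<b
        (subst₂ _<ᶠ_ (sym (inverseˡ π)) (sym (inverseˡ π)) (ℕ.≤-reflexive (sym eq)))
      = ℕ.<⇒≱ 0<j′ (subst (_≤ toℕ (pos zero)) (sym eq) j<0)
      where
      0<j′ : pos zero <ᶠ j′
      0<j′ = subst (pos zero <ᶠ_) (inverseˡ π) (split Uπ refl Wb)
      j<0 : j <ᶠ pos zero
      j<0 = subst (_<ᶠ pos zero) (inverseˡ π)
        (falling Uπ {zero} (subst (0 <_) (sym a≡c+1) z<s) (sym Wa))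

    unshuffles⇒word≡ : fishburnWord π ≡ u
    unshuffles⇒word≡ = trans (tabulate-cong letter) (tabulate∘lookup u)
      where
      letter : ∀ v → does (pos (suc v) ≤? pos zero) ≡ lookup u v
      letter v with lookup u v in uv
      ... | true  = dec-true (pos (suc v) ≤? pos zero) (ℕ.<⇒≤ (falling Uπ {zero} z<s (sym uv)))
      ... | false = dec-false (pos (suc v) ≤? pos zero) (ℕ.<⇒≱ (split Uπ {zero} refl uv))

-- Equality in `F` compares only the forward maps, while the word is read off the inverse.
fishburnWord-cong : (π ρ : Permutation′ (suc m)) → (∀ i → π ⟨$⟩ʳ i ≡ ρ ⟨$⟩ʳ i) → fishburnWord π ≡ fishburnWord ρ
fishburnWord-cong π ρ π≗ρ =
  tabulate-cong λ v → cong₂ (λ i j → does (i ≤? j)) (pos≡ (suc v)) (pos≡ zero)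
  where
  pos≡ : ∀ x → π ⟨$⟩ˡ x ≡ ρ ⟨$⟩ˡ x
  pos≡ x = ʳ-injective ρ (trans (sym (π≗ρ _)) (trans (inverseʳ π) (sym (inverseʳ ρ))))

-- Subwords

-- A position map, so that the value map of a copy of a pattern can serve directly as an embedding.
record _⊑_ (w : Vec Bool k) (v : Vec Bool m) : Set where
  constructor embed
  field
    position   : Fin k → Fin m
    increasing : StrictMono position
    letters    : ∀ x → lookup v (position x) ≡ lookup w x

infix 4 _⊑_

⊑-unskip : ∀ {w : Vec Bool k} {c} {v : Vec Bool m} (g : Fin k → Fin (suc m)) → StrictMono g →
  (∀ x → lookup (c ∷ v) (g x) ≡ lookup w x) → (∀ x → zero ≢ g x) → w ⊑ v
⊑-unskip {c = c} {v} g mono letters 0≢g = embed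
  (λ x → punchOut (0≢g x))
  (λ {i} {j} i<j → ℕ.≤-pred (subst₂ _<ᶠ_ (sym (punchIn-punchOut (0≢g i))) (sym (punchIn-punchOut (0≢g j))) (mono i<j)))
  (λ x → trans (cong (lookup (c ∷ v)) (punchIn-punchOut (0≢g x))) (letters x))

0≢strictMono : {g : Fin k → Fin (suc m)} → StrictMono g → ∀ {i j} → i <ᶠ j → zero ≢ g j
0≢strictMono {g = g} mono {i} i<j eq = ℕ.n≮0 {toℕ (g i)} (subst (g i <ᶠ_) (sym eq) (mono i<j))

[]⊑ : {v : Vec Bool m} → [] ⊑ v
[]⊑ = embed (λ ()) (λ { {()} }) (λ ())

∷⋢[] : ∀ {b} {w : Vec Bool k} → ¬ (b ∷ w ⊑ [])
∷⋢[] (embed g _ _) with () ← g zero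

⊑-skip : ∀ {w : Vec Bool k} {c} {v : Vec Bool m} → w ⊑ v → w ⊑ c ∷ v
⊑-skip (embed g mono letters) = embed (suc ∘ g) (λ lt → s<s (mono lt)) letters

⊑-match : ∀ {w : Vec Bool k} {b} {v : Vec Bool m} → w ⊑ v → b ∷ w ⊑ b ∷ v
⊑-match {k} {m} {w} {b} {v} (embed g mono letters) = embed g′ mono′ letters′
  where
  g′ : Fin (suc k) → Fin (suc m)
  g′ zero    = zero
  g′ (suc x) = suc (g x)
  mono′ : StrictMono g′
  mono′ {zero}  {suc j} _         = z<s
  mono′ {suc i} {suc j} (s<s i<j) = s<s (mono i<j)
  letters′ : ∀ x → lookup (b ∷ v) (g′ x) ≡ lookup (b ∷ w) x
  letters′ zero    = refl
  letters′ (suc x) = letters x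

-- Only the first letter of the subword can occupy position `zero`; all later ones lie strictly to
-- its right.
⊑-unmatch : ∀ {w : Vec Bool k} {b c} {v : Vec Bool m} → b ∷ w ⊑ c ∷ v → w ⊑ v
⊑-unmatch {c = c} (embed g mono letters) =
  ⊑-unskip {c = c} (g ∘ suc) (λ lt → mono (s<s lt)) (letters ∘ suc) (λ x → 0≢strictMono mono {zero} z<s)

⊑-mismatch : ∀ {w : Vec Bool k} {b c} {v : Vec Bool m} → b ≢ c → b ∷ w ⊑ c ∷ v → b ∷ w ⊑ v
⊑-mismatch {b = b} {c} {v} b≢c (embed g mono letters) = ⊑-unskip g mono letters λ where
  zero    eq → b≢c (sym (trans (cong (lookup (c ∷ v)) eq) (letters zero)))
  (suc x) eq → 0≢strictMono mono {zero} z<s eq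

-- Counting the words that avoid a subword

-- Arguments are the lengths of the word and of the subword. The summands of the recursion are the
-- words whose first letter matches that of the subword and those where it does not.
avoiderCount : ℕ → ℕ → ℕ
avoiderCount _       zero    = 0
avoiderCount zero    (suc k) = 1
avoiderCount (suc m) (suc k) = avoiderCount m k + avoiderCount m (suc k)

Avoiders : Vec Bool k → ℕ → Setoid 0ℓ 0ℓ
Avoiders w m = On.setoid {B = ∃[ v ] ¬ (w ⊑ v)} (setoid (Vec Bool m)) proj₁

-- The avoidance proof is irrelevant, so the index depends on the word alone, as equality in
-- `Avoiders` requires.
index : (w : Vec Bool k) (v : Vec Bool m) → .(¬ (w ⊑ v)) → Fin (avoiderCount m k)
index []      v       w⋢v = ⊥-elim-irr (w⋢v []⊑)
index (b ∷ w) []      w⋢v = zero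
index (b ∷ w) (c ∷ v) w⋢v with b Bool.≟ c
... | yes refl = index w v (λ w⊑v → w⋢v (⊑-match w⊑v)) ↑ˡ _
... | no _     = _ ↑ʳ index (b ∷ w) v (λ w⊑v → w⋢v (⊑-skip w⊑v))

avoider : (w : Vec Bool k) (m : ℕ) → Fin (avoiderCount m k) → Vec Bool m
avoider (b ∷ w) zero    i = []
avoider {suc k} (b ∷ w) (suc m) i with splitAt (avoiderCount m k) i
... | inj₁ j = b ∷ avoider w m j
-- Over two letters there is exactly one mismatching letter, so the count is independent of `w`.
... | inj₂ j = not b ∷ avoider (b ∷ w) m j

avoider-avoids : (w : Vec Bool k) (m : ℕ) (i : Fin (avoiderCount m k)) → ¬ (w ⊑ avoider w m i)
avoider-avoids (b ∷ w) zero    i = ∷⋢[]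
avoider-avoids {suc k} (b ∷ w) (suc m) i with splitAt (avoiderCount m k) i
... | inj₁ j = avoider-avoids w m j ∘ ⊑-unmatch
... | inj₂ j = avoider-avoids (b ∷ w) m j ∘ ⊑-mismatch (Bool.not-¬ refl)

avoider-index : (w : Vec Bool k) (v : Vec Bool m) .(w⋢v : ¬ (w ⊑ v)) → avoider w m (index w v w⋢v) ≡ v
avoider-index []      v       w⋢v = ⊥-elim-irr (w⋢v []⊑)
avoider-index (b ∷ w) []      w⋢v = refl
avoider-index {suc k} {suc m} (b ∷ w) (c ∷ v) w⋢v with b Bool.≟ c
... | yes refl
  rewrite splitAt-↑ˡ (avoiderCount m k) (index w v (λ w⊑v → w⋢v (⊑-match w⊑v))) (avoiderCount m (suc k))
  = cong (b ∷_) (avoider-index w v _)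
... | no b≢c
  rewrite splitAt-↑ʳ (avoiderCount m k) (avoiderCount m (suc k)) (index (b ∷ w) v (λ w⊑v → w⋢v (⊑-skip w⊑v)))
  = cong₂ _∷_ (sym (Bool.¬-not (b≢c ∘ sym))) (avoider-index (b ∷ w) v _)

index-match : (w : Vec Bool k) (b : Bool) (v : Vec Bool m) .(w⋢v : ¬ (w ⊑ v)) .(p : ¬ (b ∷ w ⊑ b ∷ v)) →
  index (b ∷ w) (b ∷ v) p ≡ index w v w⋢v ↑ˡ _
index-match w b v _ _ with b Bool.≟ b
... | yes refl = refl
... | no b≢b   = contradiction refl b≢b

index-mismatch : (w : Vec Bool k) (b : Bool) (v : Vec Bool m) .(w⋢v : ¬ (b ∷ w ⊑ v)) .(p : ¬ (b ∷ w ⊑ not b ∷ v)) →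
  index (b ∷ w) (not b ∷ v) p ≡ _ ↑ʳ index (b ∷ w) v w⋢v
index-mismatch w true  v _ _ = refl
index-mismatch w false v _ _ = refl

index-avoider : (w : Vec Bool k) (m : ℕ) (i : Fin (avoiderCount m k)) .(p : ¬ (w ⊑ avoider w m i)) →
  index w (avoider w m i) p ≡ i
index-avoider (b ∷ w) zero    zero p = refl
index-avoider {suc k} (b ∷ w) (suc m) i p
  with splitAt (avoiderCount m k) i | join-splitAt (avoiderCount m k) (avoiderCount m (suc k)) i
... | inj₁ j | refl = trans (index-match w b _ (avoider-avoids w m j) p) (cong (_↑ˡ _) (index-avoider w m j _))
... | inj₂ j | refl = trans (index-mismatch w b _ (avoider-avoids (b ∷ w) m j) p)
                            (cong (_ ↑ʳ_) (index-avoider (b ∷ w) m j _))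

index-cong : (w : Vec Bool k) {u v : Vec Bool m} .{p : ¬ (w ⊑ u)} .{q : ¬ (w ⊑ v)} → u ≡ v → index w u p ≡ index w v q
index-cong w refl = refl

∣Avoiders∣ : (w : Vec Bool k) (m : ℕ) → ∣ Avoiders w m ∣≡ avoiderCount m k
∣Avoiders∣ w m = record
  { to        = λ (v , w⋢v) → index w v w⋢v
  ; from      = λ i → avoider w m i , avoider-avoids w m i
  ; to-cong   = index-cong w
  ; from-cong = cong (avoider w m)
  ; inverse   = (λ {i} eq → trans (index-cong w eq) (index-avoider w m i (avoider-avoids w m i)))
              , (λ { {v , w⋢v} refl → avoider-index w v w⋢v })
  }

-- Sums of binomial coefficients

sum-applyUpTo-+ : (f g : ℕ → ℕ) → ∀ k →
  sum (applyUpTo (λ j → f j + g j) k) ≡ sum (applyUpTo f k) + sum (applyUpTo g k)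
sum-applyUpTo-+ f g zero    = refl
sum-applyUpTo-+ f g (suc k) = trans
  (cong (f 0 + g 0 +_) (sum-applyUpTo-+ (f ∘ suc) (g ∘ suc) k))
  (interchange (f 0) (g 0) (sum (applyUpTo (f ∘ suc) k)) (sum (applyUpTo (g ∘ suc) k)))
  where open import Algebra.Properties.CommutativeSemigroup ℕ.+-commutativeSemigroup using (interchange)

applyUpTo-cong : {f g : ℕ → ℕ} → (∀ j → f j ≡ g j) → ∀ k → applyUpTo f k ≡ applyUpTo g k
applyUpTo-cong f≗g zero    = refl
applyUpTo-cong f≗g (suc k) = cong₂ _∷_ (f≗g 0) (applyUpTo-cong (f≗g ∘ suc) k)

sum-zeros : ∀ k → sum (applyUpTo (λ _ → 0) k) ≡ 0
sum-zeros zero    = refl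
sum-zeros (suc k) = sum-zeros k

avoiderCount≡sum : ∀ m k → avoiderCount m k ≡ sum (applyUpTo (m C_) k)
avoiderCount≡sum m       zero    = refl
avoiderCount≡sum zero    (suc k) = cong suc (sym (sum-zeros k))
avoiderCount≡sum (suc m) (suc k) = begin
  avoiderCount m k + avoiderCount m (suc k)
    ≡⟨ cong₂ _+_ (avoiderCount≡sum m k) (avoiderCount≡sum m (suc k)) ⟩
  -- The `suc` is the term `m C 0`; `P` and `Q` are then added termwise by Pascal's rule.
  P + suc Q
    ≡⟨ ℕ.+-suc P Q ⟩
  suc (P + Q)
    ≡⟨ cong suc (sum-applyUpTo-+ (m C_) (λ j → m C suc j) k) ⟨
  suc (sum (applyUpTo (λ j → m C j + m C suc j) k))
    ≡⟨ cong (suc ∘ sum) (applyUpTo-cong (nCk+nC[k+1]≡[n+1]C[k+1] m) k) ⟩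
  sum (applyUpTo (suc m C_) (suc k)) ∎
  where
  open ≡-Reasoning
  P = sum (applyUpTo (m C_) k)
  Q = sum (applyUpTo (λ j → m C suc j) k)

-- Restrictive patterns

module _ (σ : Permutation′ k) (restrictive : Restrictive σ) where

  private
    pos = σ ⟨$⟩ˡ_
    ascent = proj₁ (proj₂ restrictive)
    j  = proj₁ ascent
    j′ = proj₁ (proj₂ ascent)
    l  = proj₁ (proj₂ (proj₂ ascent))
    j′≡j+1 : toℕ j′ ≡ suc (toℕ j)
    j′≡j+1 = proj₁ (proj₂ (proj₂ (proj₂ ascent)))
    j′<l : j′ <ᶠ l
    j′<l = proj₁ (proj₂ (proj₂ (proj₂ (proj₂ ascent))))
    a = σ ⟨$⟩ʳ j
    b = σ ⟨$⟩ʳ j′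
    c = σ ⟨$⟩ʳ l
    a≡c+1 : toℕ a ≡ suc (toℕ c)
    a≡c+1 = proj₁ (proj₂ (proj₂ (proj₂ (proj₂ (proj₂ ascent)))))
    a<b : a <ᶠ b
    a<b = proj₂ (proj₂ (proj₂ (proj₂ (proj₂ (proj₂ ascent)))))
    j<j′ : j <ᶠ j′
    j<j′ = ℕ.≤-reflexive (sym j′≡j+1)

  -- The cut falls inside the ascent of the chosen copy of f: `j` ends the first block and `j′`
  -- starts the second.
  restrictiveWord : Vec Bool k
  restrictiveWord = tabulate λ v → does (pos v ≤? j)

  private
    lookup-w : ∀ v → lookup restrictiveWord v ≡ does (pos v ≤? j)
    lookup-w = lookup∘tabulate _

    w-true : ∀ v → lookup restrictiveWord v ≡ true → pos v ≤ᶠ j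
    w-true v wv = does-true⇒ (pos v ≤? j) (trans (sym (lookup-w v)) wv)

    w-false : ∀ v → lookup restrictiveWord v ≡ false → j′ ≤ᶠ pos v
    w-false v wv = subst (_≤ toℕ (pos v)) (sym j′≡j+1)
      (ℕ.≰⇒> (does-false⇒ (pos v ≤? j) (trans (sym (lookup-w v)) wv)))

  -- An increasing pair within one block would be a second rise beside the ascent at `j`, `j′`,
  -- against `noTwoRises`.
  restrictiveWord-unshuffles : Unshuffles restrictiveWord σ
  restrictiveWord-unshuffles = record
    { falling = falling′
    ; split   = λ {x} {y} wx wy → ℕ.≤-<-trans (w-true x wx) (ℕ.<-≤-trans j<j′ (w-false y wy))
    }
    where
    falling′ : ∀ {x y} → x <ᶠ y → lookup restrictiveWord x ≡ lookup restrictiveWord y → pos y <ᶠ pos x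
    falling′ {x} {y} x<y eq with <-cmp (pos x) (pos y)
    ... | tri> _ _ py<px = py<px
    ... | tri≈ _ px≡py _ = contradiction x<y (<-irrefl (ˡ-injective σ px≡py))
    ... | tri< px<py _ _ with lookup restrictiveWord x in wx
    ...   | true  = contradiction a<b (noTwoRises σ restrictive px<py (w-true y (sym eq)) j<j′
                      (subst₂ _<ᶠ_ (sym (inverseʳ σ)) (sym (inverseʳ σ)) x<y))
    ...   | false = contradiction (subst₂ _<ᶠ_ (sym (inverseʳ σ)) (sym (inverseʳ σ)) x<y)
                      (noTwoRises σ restrictive j<j′ (w-false x wx) px<py a<b)

  module _ {u : Vec Bool m} {π : Permutation′ (suc m)} (Uπ : Unshuffles (true ∷ u) π) where

    ⊑⇒contains : restrictiveWord ⊑ u → Contains π σ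
    ⊑⇒contains (embed g mono letters) =
      contains-of-letters restrictiveWord-unshuffles Uπ (suc ∘ g) (λ lt → s<s (mono lt)) letters

    contains⇒⊑ : Contains π σ → restrictiveWord ⊑ u
    contains⇒⊑ (ι , mono , iff) = ⊑-unskip G G-mono letters 0≢G
      where
      -- Sends each value of `σ` to the value of `π` that represents it in the copy.
      G : Fin k → Fin (suc m)
      G x = π ⟨$⟩ʳ ι (pos x)

      G-mono : StrictMono G
      G-mono x<y = Equivalence.from (iff _ _) (subst₂ _<ᶠ_ (sym (inverseʳ σ)) (sym (inverseʳ σ)) x<y)

      G-pos-< : ∀ {x y} → pos x <ᶠ pos y → π ⟨$⟩ˡ G x <ᶠ π ⟨$⟩ˡ G y
      G-pos-< px<py = subst₂ _<ᶠ_ (sym (inverseˡ π)) (sym (inverseˡ π)) (mono px<py)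

      G-pos-≤ : ∀ {x y} → pos x ≤ᶠ pos y → π ⟨$⟩ˡ G x ≤ᶠ π ⟨$⟩ˡ G y
      G-pos-≤ {x} {y} px≤py with pos x ≟ pos y
      ... | yes px≡py = ℕ.≤-reflexive (cong (λ p → toℕ (π ⟨$⟩ˡ (π ⟨$⟩ʳ ι p))) px≡py)
      ... | no  px≢py = ℕ.<⇒≤ (G-pos-< (≤∧≢⇒< px≤py px≢py))

      -- The ascent of σ can only be mapped across the boundary of the blocks.
      ascent-letters : lookup (true ∷ u) (G a) ≡ true × lookup (true ∷ u) (G b) ≡ false
      ascent-letters = rise Uπ (G-mono a<b)
        (G-pos-< (subst₂ _<ᶠ_ (sym (inverseˡ σ)) (sym (inverseˡ σ)) j<j′))

      letters : ∀ x → lookup (true ∷ u) (G x) ≡ lookup restrictiveWord x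
      letters x with lookup restrictiveWord x in wx
      ... | true  = true-downward Uπ (proj₁ ascent-letters)
        (G-pos-≤ (subst (pos x ≤ᶠ_) (sym (inverseˡ σ)) (w-true x wx)))
      ... | false = false-upward Uπ (proj₂ ascent-letters)
        (G-pos-≤ (subst (_≤ᶠ pos x) (sym (inverseˡ σ)) (w-false x wx)))

      -- The value `c` lies in the second block. A first-block value below `c` would be below `a`,
      -- hence right of `a`, although `a` ends that block.
      c<true : ∀ x → lookup restrictiveWord x ≡ true → c <ᶠ x
      c<true x wx with <-cmp c x
      ... | tri< c<x _ _ = c<x
      ... | tri≈ _ refl _ = contradiction (w-true c wx)
        (ℕ.<⇒≱ (<-trans j<j′ (subst (j′ <ᶠ_) (sym (inverseˡ σ)) j′<l)))
      ... | tri> _ _ x<c = contradiction (w-true x wx) (ℕ.<⇒≱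
        (subst (_<ᶠ pos x) (inverseˡ σ) (falling restrictiveWord-unshuffles x<a
          (trans wx (sym (trans (lookup-w a) (dec-true (pos a ≤? j) (ℕ.≤-reflexive (cong toℕ (inverseˡ σ))))))))))
        where
        x<a : x <ᶠ a
        x<a = ℕ.<-trans x<c (ℕ.≤-reflexive (sym a≡c+1))

      -- As `zero` has letter `true`, a value sent to it would lie in the first block, hence above
      -- `c`, and `G c` would be negative.
      0≢G : ∀ x → zero ≢ G x
      0≢G x 0≡Gx = 0≢strictMono G-mono
        (c<true x (trans (sym (letters x)) (cong (lookup (true ∷ u)) (sym 0≡Gx)))) 0≡Gx

  F↔Avoiders : ∀ m → Inverse (F (suc m) ((3 , p123) ∷ (k , σ) ∷ [])) (Avoiders restrictiveWord m)
  F↔Avoiders m = record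
    { to        = λ { (π , fish , no123 ∷ noσ ∷ []) →
                      fishburnWord π , noσ ∘ ⊑⇒contains (fishburn⇒unshuffles π fish no123) }
    ; from      = λ { (u , w⋢u) → let U = unshuffle-unshuffles (true ∷ u) in
                      unshuffle (true ∷ u) , unshuffles⇒fishburn _ U ,
                      unshuffles⇒avoids123 _ U ∷ (w⋢u ∘ contains⇒⊑ U) ∷ [] }
    ; to-cong   = λ { {π , _ , _ ∷ _ ∷ []} {ρ , _ , _ ∷ _ ∷ []} eq → fishburnWord-cong π ρ eq }
    ; from-cong = λ { refl _ → refl }
    ; inverse   =
        (λ { {u , _} {π , _ , _ ∷ _ ∷ []} eq →
             trans (fishburnWord-cong π (unshuffle (true ∷ u)) eq) (unshuffles⇒word≡ _ (unshuffle-unshuffles (true ∷ u))) })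
      , (λ { {π , fish , no123 ∷ _ ∷ []} refl i →
             unshuffles-unique (unshuffle-unshuffles (true ∷ fishburnWord π)) (fishburn⇒unshuffles π fish no123) i })
    }

-- The empty permutation and the final count

∣F₀∣ : (σ : Permutation′ (suc k)) → ∣ F 0 ((3 , p123) ∷ (suc k , σ) ∷ []) ∣≡ 1
∣F₀∣ σ = record
  { to        = λ _ → zero
  ; from      = λ _ → id , (λ ()) , (λ (ι , _) → noFin0 (ι zero)) ∷ (λ (ι , _) → noFin0 (ι zero)) ∷ []
  ; to-cong   = λ _ → refl
  ; from-cong = λ _ ()
  ; inverse   = (λ { {zero} _ → refl }) , λ _ ()
  }
  where
  noFin0 : ¬ Fin 0
  noFin0 ()

sum-binom₋₁-zero : ∀ k → sum (map (binom₋₁ zero) (upTo (suc k))) ≡ 1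
sum-binom₋₁-zero k = trans (cong sum (map-upTo (binom₋₁ zero) (suc k))) (cong suc (sum-zeros k))

proposition6p7 : ∀ (k : ℕ) → 3 ≤ k →
    ∀ (σ : Permutation′ k) → Restrictive σ →
    ∀ (n : ℕ) →
    ∣ F n ((3 , p123) ∷ (k , σ) ∷ []) ∣≡ sum (map (binom₋₁ n) (upTo k))
-- Words encode only permutations of positive length. For length 0 the convention leaves the single
-- term 1, and the nonempty patterns are avoided trivially.
proposition6p7 (suc k) _ σ _ zero =
  subst (∣ F 0 ((3 , p123) ∷ (suc k , σ) ∷ []) ∣≡_) (sym (sum-binom₋₁-zero k)) (∣F₀∣ σ)
proposition6p7 k _ σ restrictive (suc m) =
  subst (∣ F (suc m) ((3 , p123) ∷ (k , σ) ∷ []) ∣≡_)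
    (trans (avoiderCount≡sum m k) (cong sum (sym (map-upTo (m C_) k))))
    (inverse (F↔Avoiders σ restrictive m) (∣Avoiders∣ (restrictiveWord σ restrictive) m))
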